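{- Let $a,b\ge1$ be even integers. Then the Horadam cube $\Pi^{a,b}_n$ is Hamiltonian for every $n\ge3$.
   Context: For integers $a,b\ge1$ and $n\ge 0$, $\mathcal S^{a,b}_n$ is the set of all strings of length $n$ over the alphabet $\{0,1,\dots,a+b-1\}$ in which every letter from $\{a,\dots,a+b-1\}$ appears only immediately after a letter $0$. The Horadam cube $\Pi^{a,b}_n$ is the simple graph with vertex set $\mathcal S^{a,b}_n$ in which $x_1\cdots x_n$ and $y_1\cdots y_n$ are adjacent if and only if $\sum_{i=1}^n|x_i-y_i|=1$. A graph is Hamiltonian if it contains a cycle visiting each vertex exactly once. -}

module Defs where

open import Data.Fin.Base using (Fin; toℕ)
open import Data.List.Base using (List; _∷_; _∷ʳ_; length)
open import Data.List.Membership.Propositional using (_∈_)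
open import Data.List.Relation.Unary.Linked using (Linked)
open import Data.List.Relation.Unary.Unique.Propositional using (Unique)
open import Data.Nat.Base using (ℕ; suc; _+_; _≤_; ∣_-_∣)
open import Data.Nat.Properties using (0≢1+n; ∣-∣-comm; ∣n-n∣≡0)
open import Data.Product.Base using (∃-syntax; _×_)
open import Data.Refinement using (Refinement-syntax; value)
open import Data.Vec.Base using (Vec; []; _∷_; lookup; sum; zipWith)
open import Level using (0ℓ)
open import Relation.Binary.Core using (Rel)
open import Relation.Binary.Definitions using (Irreflexive; Symmetric)
open import Relation.Binary.PropositionalEquality
  using (_≡_; refl; sym; trans; cong₂)

record SimpleGraph : Set₁ where
  field
    Vertex : Set
    Adj    : Rel Vertex 0ℓ
    symm   : Symmetric Adj
    irrefl : Irreflexive _≡_ Adj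

module _ (G : SimpleGraph) where
  open SimpleGraph G using (Vertex; Adj)

  -- The cycle start, rest₁, …, restₖ, start; the requirement 2 ≤ k says
  -- that it has at least three vertices.
  record Cycle : Set where
    field
      start     : Vertex
      rest      : List Vertex
      2≤length  : 2 ≤ length rest
      distinct  : Unique (start ∷ rest)
      adjacent  : Linked Adj (start ∷ (rest ∷ʳ start))

    vertices : List Vertex
    vertices = start ∷ rest

  -- A cycle has no repeated vertex, so one that visits every vertex
  -- visits it exactly once.
  Hamiltonian : Set
  Hamiltonian = ∃[ C ] (∀ v → v ∈ Cycle.vertices C)

Word : ℕ → ℕ → ℕ → Set
Word a b n = Vec (Fin (a + b)) n

-- In particular the first letter of an admissible word is less than a.
Admissible : ∀ a b {n} → Word a b n → Set
Admissible a b w =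
  ∀ i → a ≤ toℕ (lookup w i) →
  ∃[ j ] (toℕ i ≡ suc (toℕ j) × toℕ (lookup w j) ≡ 0)

-- Admissibility is an irrelevant component of a refinement, so two
-- elements of 𝒮 a b n are equal as soon as the underlying words are.
𝒮 : ℕ → ℕ → ℕ → Set
𝒮 a b n = [ w ∈ Word a b n ∣ Admissible a b w ]

distance : ∀ {m n} → Vec (Fin m) n → Vec (Fin m) n → ℕ
distance xs ys = sum (zipWith (λ x y → ∣ toℕ x - toℕ y ∣) xs ys)

distance-comm : ∀ {m n} (xs ys : Vec (Fin m) n) →
                distance xs ys ≡ distance ys xs
distance-comm []       []       = refl
distance-comm (x ∷ xs) (y ∷ ys) =
  cong₂ _+_ (∣-∣-comm (toℕ x) (toℕ y)) (distance-comm xs ys)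

distance-refl : ∀ {m n} (xs : Vec (Fin m) n) → distance xs xs ≡ 0
distance-refl []       = refl
distance-refl (x ∷ xs) = cong₂ _+_ (∣n-n∣≡0 (toℕ x)) (distance-refl xs)

Π : ℕ → ℕ → ℕ → SimpleGraph
Π a b n = record
  { Vertex = 𝒮 a b n
  ; Adj    = λ x y → distance (value x) (value y) ≡ 1
  ; symm   = λ {x} {y} d≡1 →
               trans (distance-comm (value y) (value x)) d≡1
  ; irrefl = λ { {x} refl d≡1 →
               0≢1+n (trans (sym (distance-refl (value x))) d≡1) }
  }

{-# OPTIONS --safe #-}
module Submission where

-- Call a letter low if it is less than a and high otherwise, let t be the
-- greatest low letter, and let H = v ∷ T be a Hamiltonian path of Π (n + 1)
-- with v = tⁿ⁺¹. Since a is even, the product of the path of low letters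
-- with H has a Hamiltonian cycle: traverse T once per low letter, in
-- alternating directions, and return through the column over v. The words
-- 0 ∷ x ∷ u with x high form a similar product with a path u₀ ∷ U of Π n,
-- which also has a Hamiltonian cycle as b is even. Every path here begins
-- with the words t…tt, t…t(t − 1), so the edge between the words
-- 0 t t…tt and 0 t t…t(t − 1) of the first cycle has a parallel edge in the
-- second one, and the two cycles can be merged there. Cutting the merged
-- cycle at its edge from t…tt to (t − 1)t…t gives the path for the next
-- induction step. The induction starts at Π 1, a path, and Π 2, a grid with
-- a pendant path; neither has a Hamiltonian cycle, but both have a suitable
-- Hamiltonian path.

open import Defs
open import Data.Empty using (⊥)
open import Data.Fin.Base
  using (Fin; zero; suc; toℕ; fromℕ; inject₁; opposite; splitAt; _↑ˡ_; _↑ʳ_)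
open import Data.Fin.Properties
  using ( toℕ-fromℕ; toℕ-inject₁; toℕ-↑ˡ; toℕ-↑ʳ; toℕ<n; toℕ-injective
        ; ↑ˡ-injective; ↑ʳ-injective; opposite-involutive
        ; splitAt⁻¹-↑ˡ; splitAt⁻¹-↑ʳ; fromℕ≢inject₁)
  renaming (_≟_ to _≟ᶠ_)
open import Data.Irrelevant using ([_])
open import Data.List.Base
  using ( List; []; _∷_; _++_; _∷ʳ_; map; reverse; length; tabulate
        ; cartesianProductWith)
open import Data.List.Membership.Propositional using (_∈_)
open import Data.List.Membership.Propositional.Properties
  using ( ∈-map⁺; ∈-map⁻; ∈-++⁺ˡ; ∈-++⁺ʳ; ∈-++⁻; ∈-tabulate⁺; ∈-tabulate⁻
        ; ∈-cartesianProductWith⁺; ∈-cartesianProductWith⁻)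
import Data.List.Membership.DecPropositional as DecMembership
open import Data.List.Properties
  using (++-assoc; ++-identityʳ; length-map; length-tabulate; map-++; unfold-reverse)
open import Data.List.Relation.Binary.Permutation.Propositional
  using (_↭_; ↭⇒↭ₛ; ↭-sym; ↭-trans; ↭-reflexive; ↭-refl; prep; module PermutationReasoning)
open import Data.List.Relation.Binary.Permutation.Propositional.Properties
  using (∈-resp-↭; ++⁺; ++⁺ˡ; ++⁺ʳ; ++-comm; shift; ↭-reverse)
  renaming (map⁺ to ↭-map⁺)
open import Data.List.Relation.Binary.Permutation.Setoid.Properties
  using (Unique-resp-↭)
open import Data.List.Relation.Unary.All as All using (All; []; _∷_)
open import Data.List.Relation.Unary.Any using (here; there)
open import Data.List.Relation.Unary.AllPairs using ([]; _∷_)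
open import Data.List.Relation.Unary.Linked using (Linked; [-]; _∷_)
import Data.List.Relation.Unary.Linked.Properties as Linked
open import Data.List.Relation.Unary.Unique.Propositional using (Unique)
import Data.List.Relation.Unary.Unique.Propositional.Properties as Unique
open import Data.Nat.Base
  using (ℕ; zero; suc; _+_; _*_; _≤_; _<_; z≤n; s≤s; ∣_-_∣)
open import Data.Nat.Divisibility using (_∣_; divides; ∣⇒≤)
open import Data.Nat.Properties
  using ( ∣-∣-comm; ∣n-n∣≡0; +-identityʳ; +-suc; ≤-trans; ≤-reflexive; <⇒≱; _<?_
        ; ≮⇒≥; m≤m+n; suc-injective)
open import Data.Product.Base using (_×_; _,_; proj₁; proj₂; ∃-syntax)
open import Data.Refinement using (value; _,_)
open import Data.Sum.Base using (inj₁; inj₂)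
open import Data.Vec.Base using (Vec; []; _∷_; replicate)
open import Data.Vec.Properties using (≡-dec; ∷-injective; ∷-injectiveˡ)
open import Function.Base using (_∘_; _on_)
open import Level using (0ℓ)
open import Relation.Binary.Core using (Rel)
open import Relation.Binary.PropositionalEquality
  using (_≡_; _≢_; refl; sym; trans; cong; cong₂; subst; setoid)
open import Relation.Nullary using (recompute; yes; no; contradiction)

-- Walks with prescribed ends and vertex lists.

data Walk {A : Set} (R : Rel A 0ℓ) : A → A → List A → Set where
  [_] : ∀ x → Walk R x x (x ∷ [])
  _∷_ : ∀ {x y z xs} → R x y → Walk R y z xs → Walk R x z (x ∷ xs)

module _ {A : Set} {R : Rel A 0ℓ} where

  walk-++ : ∀ {w x y z xs ys} →
            Walk R w x xs → R x y → Walk R y z ys → Walk R w z (xs ++ ys)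
  walk-++ [ _ ]   r q = r ∷ q
  walk-++ (s ∷ p) r q = s ∷ walk-++ p r q

  walk-reverse : (∀ x y → R x y → R y x) → ∀ {x y xs} →
                 Walk R x y xs → Walk R y x (reverse xs)
  walk-reverse sym-R [ x ] = [ x ]
  walk-reverse sym-R (_∷_ {x = x} {y} {xs = xs} r p) =
    subst (Walk R _ _) (sym (unfold-reverse x xs))
      (walk-++ (walk-reverse sym-R p) (sym-R x y r) [ x ])

  walk-tabulate : ∀ {n} (f : Fin (suc n) → A) →
                  (∀ i → R (f (inject₁ i)) (f (suc i))) →
                  Walk R (f zero) (f (fromℕ n)) (tabulate f)
  walk-tabulate {zero}  f step = [ f zero ]
  walk-tabulate {suc n} f step =
    step zero ∷ walk-tabulate (f ∘ suc) (step ∘ suc)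

  walk⇒linked : ∀ {x y z xs} → Walk R x y xs → R y z → Linked R (xs ∷ʳ z)
  walk⇒linked [ x ]           r = r ∷ [-]
  walk⇒linked (s ∷ [ x ])     r = s ∷ r ∷ [-]
  walk⇒linked (s ∷ p@(_ ∷ _)) r = s ∷ walk⇒linked p r

  walk-length : ∀ {x y xs} → Walk R x y xs → x ≢ y → 2 ≤ length xs
  walk-length [ x ]         x≢y = contradiction refl x≢y
  walk-length (r ∷ [ _ ])   x≢y = s≤s (s≤s z≤n)
  walk-length (r ∷ (_ ∷ _)) x≢y = s≤s (s≤s z≤n)

walk-map : ∀ {A B : Set} {R : Rel A 0ℓ} {S : Rel B 0ℓ} (f : A → B) →
           (∀ x y → R x y → S (f x) (f y)) →
           ∀ {x y xs} → Walk R x y xs → Walk S (f x) (f y) (map f xs)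
walk-map f f-mono [ x ]   = [ f x ]
walk-map f f-mono (r ∷ p) = f-mono _ _ r ∷ walk-map f f-mono p

-- Adjacency of letters and of words.

∣1+n-n∣≡1 : ∀ n → ∣ suc n - n ∣ ≡ 1
∣1+n-n∣≡1 zero    = refl
∣1+n-n∣≡1 (suc n) = ∣1+n-n∣≡1 n

module _ {m : ℕ} where

  _≈₁_ : Rel (Fin m) 0ℓ
  i ≈₁ j = ∣ toℕ i - toℕ j ∣ ≡ 1

  ≈₁-sym : ∀ i j → i ≈₁ j → j ≈₁ i
  ≈₁-sym i j = trans (∣-∣-comm (toℕ j) (toℕ i))

  ≈₁-suc : ∀ i j → toℕ i ≡ suc (toℕ j) → i ≈₁ j
  ≈₁-suc i j eq = trans (cong (λ k → ∣ k - toℕ j ∣) eq) (∣1+n-n∣≡1 (toℕ j))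

  module _ {n : ℕ} where

    _∼_ : Rel (Vec (Fin m) n) 0ℓ
    v ∼ w = distance v w ≡ 1

    ∼-sym : ∀ v w → v ∼ w → w ∼ v
    ∼-sym v w = trans (distance-comm w v)

  ∼-head : ∀ {n} (w : Vec (Fin m) n) i j → i ≈₁ j → (i ∷ w) ∼ (j ∷ w)
  ∼-head w i j i≈j = cong₂ _+_ i≈j (distance-refl w)

  ∼-tail : ∀ {n} (i : Fin m) (v w : Vec (Fin m) n) → v ∼ w → (i ∷ v) ∼ (i ∷ w)
  ∼-tail i v w v∼w = cong₂ _+_ (∣n-n∣≡0 (toℕ i)) v∼w

  walk-row : ∀ {n v w vs} (i : Fin m) → Walk (_∼_ {n}) v w vs →
             Walk _∼_ (i ∷ v) (i ∷ w) (map (i ∷_) vs)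
  walk-row i = walk-map (i ∷_) (∼-tail i)

  walk-column : ∀ {n i j is} (w : Vec (Fin m) n) → Walk _≈₁_ i j is →
                Walk _∼_ (i ∷ w) (j ∷ w) (map (_∷ w) is)
  walk-column w = walk-map (_∷ w) (∼-head w)

-- Products of a list of letters with a list of words.

module _ {A : Set} where

  grid : ∀ {n} → List A → List (Vec A n) → List (Vec A (suc n))
  grid = cartesianProductWith _∷_

  snake : ∀ {n} → List A → List (Vec A n) → List (Vec A (suc n))
  snake []       vs = []
  snake (i ∷ is) vs = map (i ∷_) vs ++ snake is (reverse vs)

  -- The list `ws` is separate from `vs` so that the induction hypothesis can absorb the reversal of
  -- `vs` from one row to the next.
  snake-↭ : ∀ {n} is {vs ws : List (Vec A n)} → vs ↭ ws → snake is vs ↭ grid is ws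
  snake-↭ []       p = ↭-refl
  snake-↭ (i ∷ is) p =
    ++⁺ (↭-map⁺ (i ∷_) p) (snake-↭ is (↭-trans (↭-reverse _) p))

  grid-column : ∀ {n} is (v : Vec A n) vs →
                grid is vs ++ map (_∷ v) is ↭ grid is (v ∷ vs)
  grid-column []       v vs = ↭-refl
  grid-column (i ∷ is) v vs = begin
    (row ++ grid is vs) ++ (i ∷ v) ∷ map (_∷ v) is ↭⟨ shift _ (row ++ grid is vs) _ ⟩
    (i ∷ v) ∷ (row ++ grid is vs) ++ map (_∷ v) is ≡⟨ cong ((i ∷ v) ∷_) (++-assoc row _ _) ⟩
    (i ∷ v) ∷ row ++ grid is vs ++ map (_∷ v) is   ↭⟨ prep _ (++⁺ˡ row (grid-column is v vs)) ⟩
    (i ∷ v) ∷ row ++ grid is (v ∷ vs)              ∎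
    where
    open PermutationReasoning
    row = map (i ∷_) vs

  -- Vertex count of a cycle on a product: the snake avoids `v`, and the closing column over `v`
  -- restores one word per row. `mid` leaves room for a stretch spliced in between them, and `js`
  -- for the direction in which the column is traversed.
  loop-↭ : ∀ {n is js} {v : Vec A n} {vs} mid → js ↭ is →
           snake is vs ++ mid ++ map (_∷ v) js ↭ grid is (v ∷ vs) ++ mid
  loop-↭ {is = is} {js} {v} {vs} mid js↭is = begin
    snake is vs ++ mid ++ map (_∷ v) js   ↭⟨ ++⁺ (snake-↭ is ↭-refl) (++-comm mid _) ⟩
    grid is vs ++ map (_∷ v) js ++ mid    ≡⟨ ++-assoc (grid is vs) _ _ ⟨
    (grid is vs ++ map (_∷ v) js) ++ mid  ↭⟨ ++⁺ʳ mid (++⁺ˡ (grid is vs) (↭-map⁺ (_∷ v) js↭is)) ⟩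
    (grid is vs ++ map (_∷ v) is) ++ mid  ↭⟨ ++⁺ʳ mid (grid-column is v vs) ⟩
    grid is (v ∷ vs) ++ mid               ∎
    where open PermutationReasoning

  -- The end at which a snake over n copies of a walk from s to t stops.
  far : ℕ → A → A → A
  far zero    s t = s
  far (suc n) s t = far n t s

  far-even : ∀ {n} → 2 ∣ n → ∀ s t → far n s t ≡ s
  far-even (divides q refl) = go q
    where
    go : ∀ q s t → far (q * 2) s t ≡ s
    go zero    s t = refl
    go (suc q) s t = go q s t

-- A row ending over `w` is left by changing its first letter, so the next row starts over `w` and
-- is traversed backwards. This swap of ends is the recursion of `far`.
walk-snake : ∀ {m n i j is v w vs} → Walk (_≈₁_ {m}) i j is → Walk (_∼_ {m} {n}) v w vs →
             Walk _∼_ (i ∷ v) (j ∷ far (length is) v w) (snake is vs)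
walk-snake {vs = vs} [ i ] q = subst (Walk _∼_ _ _) (sym (++-identityʳ _)) (walk-row i q)
walk-snake {w = w} (_∷_ {x = i} {j} i≈j p) q =
  walk-++ (walk-row i q) (∼-head w i j i≈j) (walk-snake p (walk-reverse ∼-sym q))

-- With evenly many rows the ends are swapped back, so the final vertex lies over `v` whatever `w`
-- is.
walk-even-snake : ∀ {m n i j is v w vs} → 2 ∣ length is →
                  Walk (_≈₁_ {m}) i j is → Walk (_∼_ {m} {n}) v w vs →
                  Walk _∼_ (i ∷ v) (j ∷ v) (snake is vs)
walk-even-snake even p q =
  subst (λ u → Walk _∼_ _ (_ ∷ u) _) (far-even even _ _) (walk-snake p q)

toℕ-opposite-inject₁ : ∀ {n} (i : Fin n) →
                       toℕ (opposite (inject₁ i)) ≡ suc (toℕ (opposite i))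
toℕ-opposite-inject₁ zero    = refl
toℕ-opposite-inject₁ (suc i) =
  trans (toℕ-inject₁ (opposite (inject₁ i)))
    (trans (toℕ-opposite-inject₁ i) (cong suc (sym (toℕ-inject₁ (opposite i)))))

opposite-fromℕ : ∀ n → opposite (fromℕ n) ≡ zero
opposite-fromℕ zero    = refl
opposite-fromℕ (suc n) = cong inject₁ (opposite-fromℕ n)

-- Admissibility when letters are added or removed in front.

module _ {a b : ℕ} where

  admissible-[] : Admissible a b []
  admissible-[] ()

  admissible-low : ∀ {n i} {w : Word a b n} →
                   toℕ i < a → Admissible a b w → Admissible a b (i ∷ w)
  admissible-low i<a adm zero    a≤ = contradiction a≤ (<⇒≱ i<a)
  admissible-low i<a adm (suc k) a≤ with j , k≡1+j , z ← adm k a≤ =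
    suc j , cong suc k≡1+j , z

  admissible-high : ∀ {n z} i {w : Word a b n} → toℕ z < a → toℕ z ≡ 0 →
                    Admissible a b w → Admissible a b (z ∷ i ∷ w)
  admissible-high i z<a z≡0 adm zero          a≤ = contradiction a≤ (<⇒≱ z<a)
  admissible-high i z<a z≡0 adm (suc zero)    a≤ = zero , refl , z≡0
  admissible-high i z<a z≡0 adm (suc (suc k)) a≤ with j , k≡1+j , z ← adm k a≤ =
    suc (suc j) , cong (2 +_) k≡1+j , z

  admissible-head : ∀ {n i} {w : Word a b n} → Admissible a b (i ∷ w) → toℕ i < a
  admissible-head {i = i} adm with toℕ i <? a
  ... | yes i<a = i<a
  ... | no  i≮a with () ← proj₁ (proj₂ (adm zero (≮⇒≥ i≮a)))

  admissible-tail : ∀ {n i j} {w : Word a b n} → toℕ j < a →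
                    Admissible a b (i ∷ j ∷ w) → Admissible a b (j ∷ w)
  admissible-tail j<a adm zero    a≤ = contradiction a≤ (<⇒≱ j<a)
  admissible-tail j<a adm (suc k) a≤ with adm (suc (suc k)) a≤
  ... | suc l , eq , z = l , suc-injective eq , z

  admissible-tail₂ : ∀ {n i j} {w : Word a b n} → 0 < a → a ≤ toℕ j →
                     Admissible a b (i ∷ j ∷ w) → toℕ i ≡ 0 × Admissible a b w
  admissible-tail₂ {i = i} {j} {w} 0<a a≤j adm = i≡0 , tail
    where
    i≡0 : toℕ i ≡ 0
    i≡0 with adm (suc zero) a≤j
    ... | zero , _ , z = z

    tail : Admissible a b w
    tail k a≤ with adm (suc (suc k)) a≤
    -- Here the 0 before the first letter of `w` would have to be `j`, which is at least `a` and
    -- hence positive.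
    ... | suc zero    , eq , z = contradiction (≤-trans a≤j (≤-reflexive z)) (<⇒≱ 0<a)
    ... | suc (suc l) , eq , z = l , suc-injective (suc-injective eq) , z

-- Enumerations of the admissible words and the cycles they yield.

record Enumerates (a b : ℕ) {n : ℕ} (ws : List (Word a b n)) : Set where
  field
    unique   : Unique ws
    sound    : ∀ {w} → w ∈ ws → Admissible a b w
    complete : ∀ {w} → Admissible a b w → w ∈ ws

enumerates-resp-↭ : ∀ {a b n} {vs ws : List (Word a b n)} →
                    vs ↭ ws → Enumerates a b vs → Enumerates a b ws
enumerates-resp-↭ p e = record
  { unique   = Unique-resp-↭ (setoid _) (↭⇒↭ₛ p) unique
  ; sound    = sound ∘ ∈-resp-↭ (↭-sym p)
  ; complete = ∈-resp-↭ p ∘ complete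
  }
  where open Enumerates e

enumerates-[] : ∀ {a b} → Enumerates a b ([] ∷ [])
enumerates-[] = record
  { unique   = [] ∷ []
  ; sound    = λ { (here refl) → admissible-[] }
  ; complete = λ { {[]} _ → here refl }
  }

module _ {a b : ℕ} where

  refineAll : ∀ {n} {ws : List (Word a b n)} → All (Admissible a b) ws → List (𝒮 a b n)
  refineAll []           = []
  refineAll (_∷_ {x = w} adm adms) = (w , [ adm ]) ∷ refineAll adms

  value-refineAll : ∀ {n} {ws : List (Word a b n)} (adms : All (Admissible a b) ws) →
                    map value (refineAll adms) ≡ ws
  value-refineAll []           = refl
  value-refineAll (_∷_ {x = w} adm adms) = cong (w ∷_) (value-refineAll adms)

  -- The passage from plain words, on which all walks and permutations are built, to the vertices of
  -- the graph. The vertex `s` closes the walk to a cycle, and `u ≢ v` ensures that this cycle has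
  -- at least three vertices.
  hamiltonian : ∀ {n s u v} {ws : List (Word a b n)} → Enumerates a b (s ∷ ws) →
                s ∼ u → Walk _∼_ u v ws → v ∼ s → u ≢ v → Hamiltonian (Π a b n)
  hamiltonian {n} {s} {u} {v} {ws} enum s∼u walk v∼s u≢v = cycle , visits
    where
    open Enumerates enum
    open DecMembership (≡-dec {n = n} (_≟ᶠ_ {a + b})) using (_∈?_)

    start : 𝒮 a b n
    start = s , [ sound (here refl) ]

    admissible : All (Admissible a b) ws
    admissible = All.tabulate (sound ∘ there)

    rest : List (𝒮 a b n)
    rest = refineAll admissible

    value-vertices : map value (start ∷ rest) ≡ s ∷ ws
    value-vertices = cong (s ∷_) (value-refineAll admissible)

    linked : Linked (_∼_ on value) (start ∷ (rest ∷ʳ start))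
    linked = Linked.map⁻ (subst (Linked _∼_)
      (trans (cong (_∷ʳ s) (sym value-vertices)) (sym (map-++ value (start ∷ rest) _)))
      (walk⇒linked (s∼u ∷ walk) v∼s))

    cycle : Cycle (Π a b n)
    cycle = record
      { start    = start
      ; rest     = rest
      ; 2≤length = subst (2 ≤_)
          (trans (cong length (sym (value-refineAll admissible))) (length-map value rest))
          (walk-length walk u≢v)
      ; distinct = Unique.map⁻ (subst Unique (sym value-vertices) unique)
      ; adjacent = linked
      }

    visits : ∀ w → w ∈ start ∷ rest
    -- `adm` is irrelevant, so the membership it proves is recovered from the decidability of
    -- membership.
    visits (w , [ adm ])
      with (_ , w∈ , refl) ← ∈-map⁻ value
             (subst (w ∈_) (sym value-vertices) (recompute (w ∈? _) (complete adm)))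
      = w∈

-- Low and high letters.

module _ (a″ b′ : ℕ) (2∣a : 2 ∣ 2 + a″) (2∣b : 2 ∣ suc b′) where

  private
    a = 2 + a″
    b = suc b′

  -- Numbered downwards, so that a snake over the low letters starts in the row of `top` and stops
  -- in the row of 0, the only letter that a high letter may follow.
  low : Fin a → Fin (a + b)
  low i = opposite i ↑ˡ b

  high : Fin b → Fin (a + b)
  high i = a ↑ʳ i

  lows lows′ highs : List (Fin (a + b))
  lows  = tabulate low
  lows′ = tabulate (low ∘ suc)
  highs = tabulate high

  top next : Fin (a + b)
  top  = low zero
  next = low (suc zero)

  lastHigh : Fin (a + b)
  lastHigh = high (fromℕ b′)

  low-step : ∀ i → low (inject₁ i) ≈₁ low (suc i)
  low-step i = ≈₁-suc (low (inject₁ i)) (low (suc i))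
    (trans (toℕ-↑ˡ _ b) (trans (toℕ-opposite-inject₁ i)
      (cong suc (sym (trans (toℕ-↑ˡ _ b) (toℕ-inject₁ (opposite i)))))))

  high-step : ∀ i → high (inject₁ i) ≈₁ high (suc i)
  high-step i = ≈₁-sym (high (suc i)) (high (inject₁ i))
    (≈₁-suc (high (suc i)) (high (inject₁ i))
      (trans (toℕ-↑ʳ a (suc i)) (trans (+-suc a (toℕ i))
        (cong suc (sym (trans (toℕ-↑ʳ a (inject₁ i)) (cong (a +_) (toℕ-inject₁ i))))))))

  high≈top : high zero ≈₁ top
  high≈top = ≈₁-suc (high zero) top (trans (toℕ-↑ʳ a zero) (trans (+-identityʳ a)
    (cong suc (sym (trans (toℕ-↑ˡ _ b) (toℕ-fromℕ (suc a″)))))))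

  walk-lows : Walk _≈₁_ top zero lows
  walk-lows = subst (λ i → Walk _≈₁_ top (i ↑ˡ b) lows) (opposite-fromℕ (suc a″))
    (walk-tabulate low low-step)

  walk-lows′ : Walk _≈₁_ next zero lows′
  walk-lows′ = subst (λ i → Walk _≈₁_ next (i ↑ˡ b) lows′) (opposite-fromℕ (suc a″))
    (walk-tabulate (low ∘ suc) (low-step ∘ suc))

  walk-highs : Walk _≈₁_ (high zero) lastHigh highs
  walk-highs = walk-tabulate high high-step

  even-lows : 2 ∣ length lows
  even-lows = subst (2 ∣_) (sym (length-tabulate low)) 2∣a

  even-highs : 2 ∣ length highs
  even-highs = subst (2 ∣_) (sym (length-tabulate high)) 2∣b

  toℕ-low : ∀ {i} → i ∈ lows → toℕ i < a
  toℕ-low i∈ with k , refl ← ∈-tabulate⁻ {f = low} i∈ =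
    subst (_< a) (sym (toℕ-↑ˡ _ b)) (toℕ<n (opposite k))

  toℕ-high : ∀ {i} → i ∈ highs → a ≤ toℕ i
  toℕ-high i∈ with k , refl ← ∈-tabulate⁻ {f = high} i∈ =
    subst (a ≤_) (sym (toℕ-↑ʳ a k)) (m≤m+n a (toℕ k))

  ∈-lows : ∀ {i} → toℕ i < a → i ∈ lows
  ∈-lows {i} i<a with splitAt a i in eq
  ... | inj₁ k = subst (_∈ lows)
    (trans (cong (_↑ˡ b) (opposite-involutive k)) (splitAt⁻¹-↑ˡ eq))
    (∈-tabulate⁺ {f = low} (opposite k))
  ... | inj₂ k = contradiction
    (subst (λ j → a ≤ toℕ j) (splitAt⁻¹-↑ʳ {m = a} eq) (toℕ-high (∈-tabulate⁺ {f = high} k)))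
    (<⇒≱ i<a)

  ∈-highs : ∀ {i} → a ≤ toℕ i → i ∈ highs
  ∈-highs {i} a≤i with splitAt a i in eq
  ... | inj₁ k = contradiction a≤i
    (<⇒≱ (subst (_< a) (trans (sym (toℕ-↑ˡ k b)) (cong toℕ (splitAt⁻¹-↑ˡ eq))) (toℕ<n k)))
  ... | inj₂ k = subst (_∈ highs) (splitAt⁻¹-↑ʳ {m = a} eq) (∈-tabulate⁺ {f = high} k)

  unique-lows : Unique lows
  unique-lows = Unique.tabulate⁺ {f = low} λ {i} {j} eq →
    trans (sym (opposite-involutive i))
      (trans (cong opposite (↑ˡ-injective b (opposite i) (opposite j) eq)) (opposite-involutive j))

  unique-highs : Unique highs
  unique-highs = Unique.tabulate⁺ (↑ʳ-injective a _ _)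

  -- Recursive enumeration of the admissible words.

  enumerates-one : Enumerates a b (grid lows ([] ∷ []))
  enumerates-one = record
    { unique   = Unique.cartesianProductWith⁺ _∷_ ∷-injective unique-lows ([] ∷ [])
    ; sound    = sound
    ; complete = λ { {i ∷ []} adm → ∈-cartesianProductWith⁺ _∷_ {ys = [] ∷ []}
                                   (∈-lows (admissible-head adm)) (here refl) }
    }
    where
    sound : ∀ {w} → w ∈ grid lows ([] ∷ []) → Admissible a b w
    sound w∈ with ∈-cartesianProductWith⁻ _∷_ lows ([] ∷ []) w∈
    ... | _ , _ , i∈ , here refl , refl = admissible-low (toℕ-low i∈) admissible-[]

  -- |𝒮 (n + 2)| = a |𝒮 (n + 1)| + b |𝒮 n|: a word starts with a free
  -- letter less than a, or with 0 followed by a letter that is at least a.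
  enumerates-step : ∀ {n} {us : List (Word a b n)} {vs} →
                    Enumerates a b us → Enumerates a b vs →
                    Enumerates a b (grid lows vs ++ map (zero ∷_) (grid highs us))
  enumerates-step {us = us} {vs} eu ev = record
    { unique   = Unique.++⁺
        (Unique.cartesianProductWith⁺ _∷_ ∷-injective unique-lows V.unique)
        (Unique.map⁺ (proj₂ ∘ ∷-injective)
          (Unique.cartesianProductWith⁺ _∷_ ∷-injective unique-highs U.unique))
        (λ (p , q) → disjoint (∈-cartesianProductWith⁻ _∷_ lows vs p) (∈-map⁻ (zero ∷_) q))
    ; sound    = sound
    ; complete = complete
    }
    where
    module U = Enumerates eu
    module V = Enumerates ev

    disjoint : ∀ {w} → ∃[ i ] ∃[ v ] (i ∈ lows × v ∈ vs × w ≡ i ∷ v) →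
               ∃[ v ] (v ∈ grid highs us × w ≡ zero ∷ v) → ⊥
    disjoint (_ , _ , _ , v∈ , refl) (_ , u∈ , refl)
      -- A common word would have a low second letter, as the head of an admissible word, and also a
      -- high one.
      with _ , _ , i∈ , _ , refl ← ∈-cartesianProductWith⁻ _∷_ highs us u∈ =
      <⇒≱ (admissible-head (V.sound v∈)) (toℕ-high i∈)

    sound : ∀ {w} → w ∈ grid lows vs ++ map (zero ∷_) (grid highs us) → Admissible a b w
    sound w∈ with ∈-++⁻ (grid lows vs) w∈
    ... | inj₁ p with _ , _ , i∈ , v∈ , refl ← ∈-cartesianProductWith⁻ _∷_ lows vs p =
      admissible-low (toℕ-low i∈) (V.sound v∈)
    ... | inj₂ p with _ , q , refl ← ∈-map⁻ (zero ∷_) p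
                 with i , _ , _ , u∈ , refl ← ∈-cartesianProductWith⁻ _∷_ highs us q =
      admissible-high i (s≤s z≤n) refl (U.sound u∈)

    complete : ∀ {w} → Admissible a b w → w ∈ grid lows vs ++ map (zero ∷_) (grid highs us)
    complete {i ∷ j ∷ w} adm with toℕ j <? a
    ... | yes j<a = ∈-++⁺ˡ (∈-cartesianProductWith⁺ _∷_
      (∈-lows (admissible-head adm)) (V.complete (admissible-tail j<a adm)))
    ... | no  j≮a with i≡0 , adm′ ← admissible-tail₂ (s≤s z≤n) (≮⇒≥ j≮a) adm
                  with refl ← toℕ-injective {i = i} {j = zero} i≡0 =
      ∈-++⁺ʳ (grid lows vs) (∈-map⁺ (zero ∷_)
        (∈-cartesianProductWith⁺ _∷_ (∈-highs (≮⇒≥ j≮a)) (U.complete adm′)))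

  -- Hamiltonian paths and the base cases.

  topWord : ∀ n → Word a b n
  topWord n = replicate n top

  nextWord : ∀ n → Word a b (suc n)
  nextWord zero    = next ∷ []
  nextWord (suc n) = top ∷ nextWord n

  nextWord∼topWord : ∀ n → nextWord n ∼ topWord (suc n)
  nextWord∼topWord zero    = ∼-head [] next top (≈₁-sym top next (low-step zero))
  nextWord∼topWord (suc n) = ∼-tail top (nextWord n) (topWord (suc n)) (nextWord∼topWord n)

  -- The first vertex is split off because snakes run over `rest` alone and the column over
  -- `topWord` comes last. The first edge is prescribed since the merging happens along it; `last`
  -- is free since even snakes do not stop over it.
  record HamiltonianPath (n : ℕ) : Set where
    field
      {rest}     : List (Word a b (suc n))
      {last}     : Word a b (suc n)
      enumerates : Enumerates a b (topWord (suc n) ∷ rest)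
      walk       : Walk _∼_ (nextWord n) last rest

  open HamiltonianPath

  path₁ : HamiltonianPath 0
  path₁ = record
    { enumerates = enumerates-resp-↭
        (↭-sym (snake-↭ lows {vs = [] ∷ []} ↭-refl)) enumerates-one
    ; walk       = walk-snake walk-lows′ [ [] ]
    }

  -- Here the snake covers the whole grid of low letters, the column over `topWord 1` included, and
  -- then enters the pendant path of the words 0 followed by a high letter. The row of `top` is
  -- separate because its first vertex is not part of `walk`.
  path₂ : HamiltonianPath 1
  path₂ = record
    { enumerates = enumerates-resp-↭
        (↭-sym (++⁺ (snake-↭ lows {vs = topWord 1 ∷ rest path₁} ↭-refl)
          (↭-map⁺ (zero ∷_) (snake-↭ highs {vs = [] ∷ []} ↭-refl))))
        (enumerates-step enumerates-[] (enumerates path₁))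
    ; walk       = walk-++
        (walk-++ (walk-row top (walk path₁))
          (∼-head (last path₁) top next (low-step zero))
          -- Together with the row of `top` there are `length lows` rows, an even number, so the
          -- snake stops at `zero ∷ topWord 1`, where the pendant path is attached.
          (subst (λ u → Walk _∼_ (next ∷ last path₁) (zero ∷ u)
                   (snake lows′ (reverse (topWord 1 ∷ rest path₁))))
            (far-even even-lows (topWord 1) (last path₁))
            (walk-snake walk-lows′ (walk-reverse ∼-sym
              (∼-sym (nextWord 0) (topWord 1) (nextWord∼topWord 0) ∷ walk path₁)))))
        (∼-tail zero (top ∷ []) (high zero ∷ [])
          (∼-head [] top (high zero) (≈₁-sym (high zero) top high≈top)))
        (walk-row zero (walk-snake walk-highs [ [] ]))
    }

  -- Merging two cycles: the induction step.

  module _ {n : ℕ} (P : HamiltonianPath n) (Q : HamiltonianPath (suc n)) where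

    v w : Word a b _
    v = topWord (suc n)
    w = topWord (suc (suc n))

    -- The cycle on the words with a high first letter, cut at its edge from `high zero ∷ v` to
    -- `high zero ∷ nextWord n`.
    detour : List (Word a b (2 + n))
    detour = snake highs (rest P) ++ map (_∷ v) (reverse highs)

    -- The cycle on the words `i ∷ u` with `i` low, without its vertex `top ∷ w`. Its edge from
    -- `zero ∷ nextWord (suc n)` to `zero ∷ w` is replaced by the detour.
    tour : List (Word a b (3 + n))
    tour = snake lows (rest Q) ++ map (zero ∷_) detour ++ map (_∷ w) (reverse lows′)

    walk-detour : Walk _∼_ (high zero ∷ nextWord n) (high zero ∷ v) detour
    walk-detour = walk-++ (walk-even-snake even-highs walk-highs (walk P))
      (∼-tail lastHigh (nextWord n) v (nextWord∼topWord n))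
      (walk-column v (walk-reverse ≈₁-sym walk-highs))

    walk-tour : Walk _∼_ (nextWord (2 + n)) (next ∷ w) tour
    walk-tour = walk-++ (walk-even-snake even-lows walk-lows (walk Q))
      (∼-tail zero (top ∷ nextWord n) (high zero ∷ nextWord n)
        (∼-head (nextWord n) top (high zero) (≈₁-sym (high zero) top high≈top)))
      (walk-++ (walk-row zero walk-detour)
        (∼-tail zero (high zero ∷ v) w (∼-head v (high zero) top high≈top))
        (walk-column w (walk-reverse ≈₁-sym walk-lows′)))

    tour-↭ : topWord (3 + n) ∷ tour ↭
             grid lows (w ∷ rest Q) ++ map (zero ∷_) (grid highs (v ∷ rest P))
    tour-↭ = begin
      (top ∷ w) ∷ s ++ m ++ c             ≡⟨ cong ((top ∷ w) ∷_) (++-assoc s m c) ⟨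
      -- Moved in front of `c`, the split-off vertex completes the column over `w` to all low
      -- letters, as `loop-↭` requires.
      (top ∷ w) ∷ (s ++ m) ++ c           ↭⟨ shift (top ∷ w) (s ++ m) c ⟨
      (s ++ m) ++ (top ∷ w) ∷ c           ≡⟨ ++-assoc s m _ ⟩
      s ++ m ++ (top ∷ w) ∷ c             ↭⟨ loop-↭ m (prep top (↭-reverse lows′)) ⟩
      grid lows (w ∷ rest Q) ++ m        ↭⟨ ++⁺ˡ _ (↭-map⁺ (zero ∷_) detour-↭) ⟩
      grid lows (w ∷ rest Q) ++ map (zero ∷_) (grid highs (v ∷ rest P)) ∎
      where
      open PermutationReasoning
      s = snake lows (rest Q)
      m = map (zero ∷_) detour
      c = map (_∷ w) (reverse lows′)

      detour-↭ : detour ↭ grid highs (v ∷ rest P)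
      detour-↭ = ↭-trans (loop-↭ [] (↭-reverse highs)) (↭-reflexive (++-identityʳ _))

    next-path : HamiltonianPath (2 + n)
    next-path = record
      { enumerates = enumerates-resp-↭ (↭-sym tour-↭)
          (enumerates-step (enumerates P) (enumerates Q))
      ; walk       = walk-tour
      }

    Π-hamiltonian : Hamiltonian (Π a b (3 + n))
    Π-hamiltonian = hamiltonian (enumerates next-path)
      (∼-sym (nextWord (2 + n)) (topWord (3 + n)) (nextWord∼topWord (2 + n))) walk-tour
      (∼-head w next top (≈₁-sym top next (low-step zero)))
      -- The ends of the tour begin with the distinct letters `top` and `next`.
      (fromℕ≢inject₁ ∘ ↑ˡ-injective b _ _ ∘ ∷-injectiveˡ)

  paths : ∀ n → HamiltonianPath n × HamiltonianPath (suc n)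
  paths zero    = path₁ , path₂
  paths (suc n) with P , Q ← paths n = Q , next-path P Q

theorem15 : ∀ (a b : ℕ) → 1 ≤ a → 1 ≤ b → 2 ∣ a → 2 ∣ b →
    ∀ (n : ℕ) → 3 ≤ n → Hamiltonian (Π a b n)
-- Evenness rules out a = 1, so there are at least two low letters and `next` exists.
theorem15 (suc zero)    _       _ _ 2∣a _ = contradiction (∣⇒≤ 2∣a) λ { (s≤s ()) }
theorem15 (suc (suc a)) (suc b) _ _ 2∣a 2∣b (suc (suc (suc n))) (s≤s (s≤s (s≤s z≤n)))
  with P , Q ← paths a b 2∣a 2∣b n = Π-hamiltonian a b 2∣a 2∣b P Q
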